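{- For every $\ell\in\mathbb{N}$ and every integer $k \geq \ell + 4$, we have $\tau_{\Psi_\ell}(k) = \ell+2$; that is, the maximum vertex-cover number among all $k$-vertex graphs $H$ with $\widehat{\Psi_\ell}(H)\neq 0$ equals $\ell+2$.
   Context: Graphs are finite, simple and undirected; $\mathbb{N}=\{1,2,3,\dots\}$. For $\ell\in\mathbb{N}$, an $\ell$-scorpion is a graph $H$ with $|V(H)|\ge \ell+4$ that admits a tuple of pairwise distinct vertices $(b,t_1,\dots,t_\ell,s)\in V(H)^{\ell+2}$ such that, writing $Q=\{b,t_1,\dots,t_\ell,s\}$ and calling the vertices in $V(H)\setminus Q$ legs: (i) $H[Q]$ is an induced path from $b$ to $s$ whose vertices in order are $b,t_1,\dots,t_\ell,s$; (ii) $b$ is adjacent to all legs; (iii) $b$ is the only vertex in $Q$ adjacent to legs. $\Psi_\ell$ is the property of being an $\ell$-scorpion, viewed as a $\{0,1\}$-valued function on graphs. For a graph property $\Phi$ (an isomorphism-invariant $\{0,1\}$-valued function on graphs) and a graph $H$, the alternating enumerator is $$\widehat{\Phi}(H) = (-1)^{|E(H)|}\sum_{S\subseteq E(H)}(-1)^{|S|}\,\Phi(H[S]),$$ where $H[S]$ is the graph with vertex set $V(H)$ and edge set $S$. $\tau_\Phi(k)$ denotes the maximal vertex-cover number (minimum size of a vertex cover) among $k$-vertex graphs $H$ with $\widehat{\Phi}(H)\ne 0$. -}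

module Defs where

open import Data.Bool using (Bool; false; T; T?; _∧_; _∨_; if_then_else_)
open import Data.Bool.Properties using (∨-comm)
open import Data.Fin using (Fin; toℕ)
import Data.Fin as Fin
import Data.Fin.Properties as Fin
open import Data.Fin.Permutation using (Permutation′; _⟨$⟩ʳ_; _⟨$⟩ˡ_; inverseˡ; inverseʳ; flip)
open import Data.Fin.Subset using (Subset; ∣_∣; _∈_; ⊤)
open import Data.Fin.Subset.Properties using (_∈?_; anySubset?; ∈⊤; ∣⊤∣≡n)
open import Data.Integer using (ℤ; 0ℤ; 1ℤ; -1ℤ)
import Data.Integer as ℤ
open import Data.List using (List; []; _∷_; _++_; map; foldr; length; filter; allFin; cartesianProduct)
open import Data.List.Membership.DecPropositional using () renaming (_∈?_ to member?)
open import Data.Nat using (ℕ; zero; suc; _+_; _≤_; _≤?_; z≤n; s≤s)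
import Data.Nat as ℕ
open import Data.Product using (_×_; _,_; proj₁; proj₂; Σ; ∃; ∃-syntax)
open import Data.Product.Properties using (≡-dec)
open import Data.Sum using (_⊎_; inj₁)
open import Data.Vec using (Vec; []; _∷_; _∷ʳ_; lookup)
import Data.Vec as Vec
import Data.Vec.Properties as Vec
open import Data.Empty using (⊥-elim)
open import Function using (_∘_; _⇔_; mk⇔; Equivalence)
open import Relation.Binary.Definitions using (DecidableEquality)
open import Relation.Binary.PropositionalEquality using (_≡_; _≢_; refl; sym; trans; cong; cong₂; subst)
open import Relation.Nullary using (Dec; yes; no; ¬?; does)
open import Relation.Nullary.Decidable using (map′; _×-dec_; _⊎-dec_; _→-dec_; does-⇔)

private
  variable
    n : ℕ

record Graph (n : ℕ) : Set where
  field
    adj        : Fin n → Fin n → Bool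
    adj-sym    : ∀ u v → adj u v ≡ adj v u
    adj-irrefl : ∀ v → adj v v ≡ false

  Adj : Fin n → Fin n → Set
  Adj u v = T (adj u v)

open Graph public

_≅_ : Graph n → Graph n → Set
_≅_ {n} G H = Σ (Permutation′ n) λ π → ∀ u v → adj G u v ≡ adj H (π ⟨$⟩ʳ u) (π ⟨$⟩ʳ v)

record GraphProperty : Set where
  field
    holds     : ∀ {n} → Graph n → Bool
    invariant : ∀ {n} (G H : Graph n) → G ≅ H → holds G ≡ holds H

open GraphProperty public

-- The edge {u , v} is represented by the pair (u , v) with u < v.
Edge : ℕ → Set
Edge n = Fin n × Fin n

_≟ᴱ_ : DecidableEquality (Edge n)
_≟ᴱ_ = ≡-dec Fin._≟_ Fin._≟_

edges : Graph n → List (Edge n)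
edges {n} H = filter (λ (u , v) → (u Fin.<? v) ×-dec T? (adj H u v)) (cartesianProduct (allFin n) (allFin n))

-- On a list without repetitions, such as 'edges H', every subset is listed exactly once.
subsets : {A : Set} → List A → List (List A)
subsets []       = [] ∷ []
subsets (x ∷ xs) = subsets xs ++ map (x ∷_) (subsets xs)

-- The conjunct 'adj H u v' is redundant when S ⊆ E(H); it makes the
-- definition total in S.
_[_] : Graph n → List (Edge n) → Graph n
H [ S ] = record
  { adj        = λ u v → adj H u v ∧ (inS u v ∨ inS v u)
  ; adj-sym    = λ u v → cong₂ _∧_ (adj-sym H u v) (∨-comm (inS u v) (inS v u))
  ; adj-irrefl = λ v → cong (_∧ (inS v v ∨ inS v v)) (adj-irrefl H v)
  }
  where
  inS : _ → _ → Bool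
  inS u v = does (member? _≟ᴱ_ (u , v) S)

sumℤ : List ℤ → ℤ
sumℤ = foldr ℤ._+_ 0ℤ

indicator : Bool → ℤ
indicator b = if b then 1ℤ else 0ℤ

alternatingEnumerator : GraphProperty → Graph n → ℤ
alternatingEnumerator Φ H =
  (-1ℤ ℤ.^ length (edges H)) ℤ.*
  sumℤ (map (λ S → (-1ℤ ℤ.^ length S) ℤ.* indicator (holds Φ (H [ S ]))) (subsets (edges H)))

IsVertexCover : Graph n → Subset n → Set
IsVertexCover H C = ∀ u v → Adj H u v → u ∈ C ⊎ v ∈ C

isVertexCover? : (H : Graph n) (C : Subset n) → Dec (IsVertexCover H C)
isVertexCover? H C =
  Fin.all? λ u → Fin.all? λ v → T? (adj H u v) →-dec ((u ∈? C) ⊎-dec (v ∈? C))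

HasCoverOfSize : Graph n → ℕ → Set
HasCoverOfSize H m = ∃[ C ] (IsVertexCover H C × ∣ C ∣ ≡ m)

IsLeast : (ℕ → Set) → ℕ → Set
IsLeast P m = P m × (∀ j → P j → m ≤ j)

least : (P : ℕ → Set) → (∀ m → Dec (P m)) → ∀ m → P m → ∃ (IsLeast P)
least P P? zero    p = zero , p , λ _ _ → z≤n
least P P? (suc m) p with P? zero
... | yes p₀ = zero , p₀ , λ _ _ → z≤n
... | no ¬p₀ with least (P ∘ suc) (P? ∘ suc) m p
...   | l , pl , l≤ = suc l , pl , λ where
        zero    p₀ → ⊥-elim (¬p₀ p₀)
        (suc j) pj → s≤s (l≤ j pj)

leastCoverSize : (H : Graph n) → ∃ (IsLeast (HasCoverOfSize H))
leastCoverSize {n} H = least (HasCoverOfSize H)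
  (λ m → anySubset? λ C → isVertexCover? H C ×-dec (∣ C ∣ ℕ.≟ m))
  n (⊤ , (λ _ _ _ → inj₁ ∈⊤) , ∣⊤∣≡n n)

vertexCoverNumber : Graph n → ℕ
vertexCoverNumber H = proj₁ (leastCoverSize H)

-- 'τ Φ ⟨ k ⟩≐ m' says that τ_Φ(k) exists and equals m; the maximum is undefined
-- when no k-vertex graph has a nonzero alternating enumerator.
τ_⟨_⟩≐_ : GraphProperty → ℕ → ℕ → Set
τ Φ ⟨ k ⟩≐ m =
    (∃[ H ] (alternatingEnumerator {k} Φ H ≢ 0ℤ × vertexCoverNumber H ≡ m))
  × (∀ (H : Graph k) → alternatingEnumerator Φ H ≢ 0ℤ → vertexCoverNumber H ≤ m)

IsLeg : ∀ {m} → Vec (Fin n) m → Fin n → Set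
IsLeg Q v = ∀ i → lookup Q i ≢ v

Consecutive : ∀ {m} → (i j : Fin m) → Set
Consecutive i j = suc (toℕ i) ≡ toℕ j ⊎ suc (toℕ j) ≡ toℕ i

module _ (H : Graph n) {ℓ : ℕ} (b : Fin n) (t : Vec (Fin n) ℓ) (s : Fin n) where

  private
    Q : Vec (Fin n) (2 + ℓ)
    Q = b ∷ (t ∷ʳ s)

  record IsScorpionTuple : Set where
    field
      distinct    : ∀ i j → lookup Q i ≡ lookup Q j → i ≡ j
      inducedPath : ∀ i j → Adj H (lookup Q i) (lookup Q j) ⇔ Consecutive i j
      b-legs      : ∀ v → IsLeg Q v → Adj H b v
      only-b      : ∀ i v → IsLeg Q v → Adj H (lookup Q i) v → lookup Q i ≡ b

  isScorpionTuple? : Dec IsScorpionTuple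
  isScorpionTuple? = map′
    (λ (d , p , l , o) → record
      { distinct    = d
      ; inducedPath = λ i j → mk⇔ (proj₁ (p i j)) (proj₂ (p i j))
      ; b-legs      = l
      ; only-b      = o })
    (λ r → let open IsScorpionTuple r in
      distinct
      , (λ i j → Equivalence.to (inducedPath i j) , Equivalence.from (inducedPath i j))
      , b-legs , only-b)
    ( Fin.all? (λ i → Fin.all? λ j → (lookup Q i Fin.≟ lookup Q j) →-dec (i Fin.≟ j))
    ×-dec Fin.all? (λ i → Fin.all? λ j →
      (T? (adj H (lookup Q i) (lookup Q j)) →-dec consecutive? i j) ×-dec
      (consecutive? i j →-dec T? (adj H (lookup Q i) (lookup Q j))))
    ×-dec Fin.all? (λ v → isLeg? v →-dec T? (adj H b v))
    ×-dec Fin.all? (λ i → Fin.all? λ v →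
      isLeg? v →-dec (T? (adj H (lookup Q i) v) →-dec (lookup Q i Fin.≟ b))))
    where
    isLeg? : ∀ v → Dec (IsLeg Q v)
    isLeg? v = Fin.all? λ i → ¬? (lookup Q i Fin.≟ v)

    consecutive? : (i j : Fin (2 + ℓ)) → Dec (Consecutive i j)
    consecutive? i j = (suc (toℕ i) ℕ.≟ toℕ j) ⊎-dec (suc (toℕ j) ℕ.≟ toℕ i)

IsScorpion : ℕ → Graph n → Set
IsScorpion {n} ℓ H =
  ℓ + 4 ≤ n × (∃[ b ] ∃[ t ] ∃[ s ] IsScorpionTuple H {ℓ} b t s)

anyVec? : ∀ {m} {P : Vec (Fin n) m → Set} → (∀ v → Dec (P v)) → Dec (∃ P)
anyVec? {m = zero}  P? = map′ (λ p → [] , p) (λ { ([] , p) → p }) (P? [])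
anyVec? {m = suc m} P? = map′
  (λ (x , v , p) → x ∷ v , p)
  (λ { (x ∷ v , p) → x , v , p })
  (Fin.any? λ x → anyVec? λ v → P? (x ∷ v))

isScorpion? : ∀ ℓ (H : Graph n) → Dec (IsScorpion ℓ H)
isScorpion? {n} ℓ H =
  (ℓ + 4 ≤? n) ×-dec
  (Fin.any? λ b → anyVec? λ t → Fin.any? λ s → isScorpionTuple? H b t s)

≅-sym : (G H : Graph n) → G ≅ H → H ≅ G
≅-sym G H (π , e) = flip π , λ u v →
  trans (cong₂ (adj H) (sym (inverseʳ π)) (sym (inverseʳ π))) (sym (e (π ⟨$⟩ˡ u) (π ⟨$⟩ˡ v)))

isScorpion-≅ : ∀ ℓ (G H : Graph n) → G ≅ H → IsScorpion ℓ G → IsScorpion ℓ H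
isScorpion-≅ {n} ℓ G H (π , e) (k≥ , b , t , s , r) =
  k≥ , f b , Vec.map f t , f s , record
    { distinct = λ i j eq → distinct i j
        (f-inj (trans (sym (lookup-Q′ i)) (trans eq (lookup-Q′ j))))
    ; inducedPath = λ i j → mk⇔
        (λ a → Equivalence.to (inducedPath i j)
          (adj← (subst T (cong₂ (adj H) (lookup-Q′ i) (lookup-Q′ j)) a)))
        (λ c → subst T (sym (cong₂ (adj H) (lookup-Q′ i) (lookup-Q′ j)))
          (adj→ (Equivalence.from (inducedPath i j) c)))
    ; b-legs = λ v leg → subst (λ w → T (adj H (f b) w)) (inverseʳ π)
        (adj→ (b-legs (g v) (leg← v leg)))
    ; only-b = λ i v leg a → trans (lookup-Q′ i) (cong f (only-b i (g v) (leg← v leg)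
        (adj← (subst T (cong₂ (adj H) (lookup-Q′ i) (sym (inverseʳ π))) a))))
    }
  where
  open IsScorpionTuple r

  f g : Fin n → Fin n
  f = π ⟨$⟩ʳ_
  g = π ⟨$⟩ˡ_

  f-inj : ∀ {x y} → f x ≡ f y → x ≡ y
  f-inj eq = trans (sym (inverseˡ π)) (trans (cong g eq) (inverseˡ π))

  adj→ : ∀ {u v} → T (adj G u v) → T (adj H (f u) (f v))
  adj→ {u} {v} = subst T (e u v)

  adj← : ∀ {u v} → T (adj H (f u) (f v)) → T (adj G u v)
  adj← {u} {v} = subst T (sym (e u v))

  Q : Vec (Fin n) (2 + ℓ)
  Q = b ∷ (t ∷ʳ s)

  lookup-Q′ : ∀ i → lookup (f b ∷ (Vec.map f t ∷ʳ f s)) i ≡ f (lookup Q i)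
  lookup-Q′ i = trans
    (cong (λ v → lookup (f b ∷ v) i) (sym (Vec.map-∷ʳ f s t)))
    (Vec.lookup-map i f Q)

  leg← : ∀ v → IsLeg (f b ∷ (Vec.map f t ∷ʳ f s)) v → IsLeg Q (g v)
  leg← v leg i eq = leg i (trans (lookup-Q′ i) (trans (cong f eq) (inverseʳ π)))

Ψ : ℕ → GraphProperty
Ψ ℓ = record
  { holds     = λ H → does (isScorpion? ℓ H)
  ; invariant = λ G H G≅H → does-⇔
      (mk⇔ (isScorpion-≅ ℓ G H G≅H) (isScorpion-≅ ℓ H G (≅-sym G H G≅H)))
      (isScorpion? ℓ G) (isScorpion? ℓ H)
  }

{-# OPTIONS --safe #-}

-- In a graph on at least ℓ + 4 vertices with ℓ ≥ 1 the scorpion tuple is unique, so the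
-- enumerator splits as a sum over tuples.  If H has an edge between two legs of a tuple,
-- toggling that edge cancels the contribution of the tuple; hence a nonzero enumerator makes
-- some spine {b , t₁ , … , tℓ , s} a vertex cover.  If the legs of a tuple are independent
-- in H, the scorpions on that tuple are spanning trees, so every surviving contribution has the
-- sign (-1)ᵏ⁻¹ and nothing cancels.  The bound is attained by the join of a clique on ℓ + 2
-- vertices with an independent set.
module Submission where

open import Data.Bool using (true; false; T; T?; _∧_; _∨_; if_then_else_)
open import Data.Bool.Properties using (T-≡; T-∧; T-∨)
open import Data.Fin using (Fin; zero; suc; toℕ; inject₁; inject≤; punchIn; punchOut; fromℕ<)
import Data.Fin as Fin
import Data.Fin.Properties as Fin
open import Data.Fin.Subset using (Subset; ∣_∣; inside; outside; _∈_; ⊥)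
open import Data.Fin.Subset.Properties using (_∈?_; ∣⊥∣≡0)
open import Data.Integer using (ℤ; 0ℤ; 1ℤ; -1ℤ; +≤+; +<+) renaming (_+_ to _+ᶻ_; _*_ to _*ᶻ_)
import Data.Integer as ℤ
import Data.Integer.Properties as ℤ
open import Data.List using (List; []; _∷_; _++_; map; length; filter; allFin; cartesianProduct; cartesianProductWith; tabulate)
import Data.List.Properties as List
open import Data.List.Membership.DecPropositional using () renaming (_∈?_ to member?)
open import Data.List.Membership.Propositional using () renaming (_∈_ to _∈ˡ_)
open import Data.List.Membership.Propositional.Properties using (∈-map⁺; ∈-map⁻; ∈-++⁺ˡ; ∈-++⁺ʳ; ∈-++⁻; ∈-cartesianProduct⁺; ∈-cartesianProductWith⁺; ∈-allFin; ∈-tabulate⁺; ∈-tabulate⁻; ∈-filter⁺; ∈-filter⁻)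
open import Data.List.Membership.Propositional.Properties.WithK using (unique∧set⇒bag)
open import Data.List.Relation.Binary.BagAndSetEquality using (∼bag⇒↭)
open import Data.List.Relation.Binary.Permutation.Propositional.Properties using (↭-length)
import Data.List.Relation.Unary.All as All
open import Data.List.Relation.Unary.All using ([]; _∷_)
open import Data.List.Relation.Unary.AllPairs using ([]; _∷_)
open import Data.List.Relation.Unary.Any using (here; there)
open import Data.List.Relation.Unary.Unique.Propositional using (Unique)
import Data.List.Relation.Unary.Unique.Propositional.Properties as Unique
open import Data.Nat using (ℕ; zero; suc; _+_; _≤_; _<_; _≤?_; _<?_; z≤n; s≤s)
import Data.Nat as ℕ
import Data.Nat.Properties as ℕ
open import Data.Product using (_×_; _,_; proj₁; proj₂; ∃; ∃-syntax; swap)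
import Data.Product.Properties as Product
open import Data.Sum using (_⊎_; inj₁; inj₂; [_,_]′)
import Data.Sum as Sum
open import Data.Vec using (Vec; []; _∷_; _∷ʳ_; lookup; initLast; _[_]≔_) renaming (here to hereᵛ; there to thereᵛ)
import Data.Vec as Vec
import Data.Vec.Properties as Vec
open import Function using (_∘_; _⇔_; mk⇔; Equivalence; case_of_; id)
open import Function.Definitions using (Injective)
open import Relation.Binary.Definitions using (tri<; tri≈; tri>)
open import Relation.Binary.PropositionalEquality using (_≡_; _≢_; refl; sym; trans; cong; cong₂; subst; subst₂; module ≡-Reasoning)
open import Relation.Nullary using (¬_; Dec; yes; no; ¬?; does; contradiction)
open import Relation.Nullary.Decidable using (dec-true; dec-false; does-⇔; _×-dec_; _⊎-dec_; decidable-stable)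
open import Defs

private
  variable
    A B : Set
    n m ℓ : ℕ

-- Finite sums

∑ : List A → (A → ℤ) → ℤ
∑ xs f = sumℤ (map f xs)

∑-cong : ∀ (xs : List A) {f g : A → ℤ} → (∀ {x} → x ∈ˡ xs → f x ≡ g x) → ∑ xs f ≡ ∑ xs g
∑-cong []       f≡g = refl
∑-cong (x ∷ xs) f≡g = cong₂ _+ᶻ_ (f≡g (here refl)) (∑-cong xs (f≡g ∘ there))

∑-zero : ∀ (xs : List A) {f : A → ℤ} → (∀ {x} → x ∈ˡ xs → f x ≡ 0ℤ) → ∑ xs f ≡ 0ℤ
∑-zero []       f≡0 = refl
∑-zero (x ∷ xs) f≡0 = cong₂ _+ᶻ_ (f≡0 (here refl)) (∑-zero xs (f≡0 ∘ there))

∑-++ : ∀ (xs ys : List A) (f : A → ℤ) → ∑ (xs ++ ys) f ≡ ∑ xs f +ᶻ ∑ ys f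
∑-++ []       ys f = sym (ℤ.+-identityˡ _)
∑-++ (x ∷ xs) ys f = trans (cong (f x +ᶻ_) (∑-++ xs ys f)) (sym (ℤ.+-assoc (f x) _ _))

∑-+ : ∀ (xs : List A) (f g : A → ℤ) → ∑ xs (λ x → f x +ᶻ g x) ≡ ∑ xs f +ᶻ ∑ xs g
∑-+ []       f g = refl
∑-+ (x ∷ xs) f g = begin
  f x +ᶻ g x +ᶻ ∑ xs (λ y → f y +ᶻ g y)   ≡⟨ cong (f x +ᶻ g x +ᶻ_) (∑-+ xs f g) ⟩
  f x +ᶻ g x +ᶻ (∑ xs f +ᶻ ∑ xs g)        ≡⟨ interchange (f x) (g x) (∑ xs f) (∑ xs g) ⟩
  f x +ᶻ ∑ xs f +ᶻ (g x +ᶻ ∑ xs g)        ∎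
  where
  open ≡-Reasoning
  open import Algebra.Properties.CommutativeSemigroup ℤ.+-commutativeSemigroup using (interchange)

∑-*ˡ : ∀ c (xs : List A) (f : A → ℤ) → c *ᶻ ∑ xs f ≡ ∑ xs (λ x → c *ᶻ f x)
∑-*ˡ c []       f = ℤ.*-zeroʳ c
∑-*ˡ c (x ∷ xs) f = trans (ℤ.*-distribˡ-+ c (f x) _) (cong (c *ᶻ f x +ᶻ_) (∑-*ˡ c xs f))

∑-swap : ∀ (xs : List A) (ys : List B) (f : A → B → ℤ) →
         ∑ xs (λ x → ∑ ys (f x)) ≡ ∑ ys (λ y → ∑ xs (λ x → f x y))
∑-swap []       ys f = sym (∑-zero ys λ _ → refl)
∑-swap (x ∷ xs) ys f = trans (cong (∑ ys (f x) +ᶻ_) (∑-swap xs ys f)) (sym (∑-+ ys (f x) _))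

∑-nonneg : ∀ (xs : List A) {f : A → ℤ} → (∀ {x} → x ∈ˡ xs → 0ℤ ℤ.≤ f x) → 0ℤ ℤ.≤ ∑ xs f
∑-nonneg []       0≤f = ℤ.≤-refl
∑-nonneg (x ∷ xs) 0≤f = ℤ.+-mono-≤ (0≤f (here refl)) (∑-nonneg xs (0≤f ∘ there))

∑-pos : ∀ {xs : List A} {f : A → ℤ} {y} → (∀ {x} → x ∈ˡ xs → 0ℤ ℤ.≤ f x) →
        y ∈ˡ xs → 0ℤ ℤ.< f y → 0ℤ ℤ.< ∑ xs f
∑-pos {xs = _ ∷ xs} 0≤f (here refl) 0<fy = ℤ.+-mono-<-≤ 0<fy (∑-nonneg xs (0≤f ∘ there))
∑-pos               0≤f (there y∈)  0<fy = ℤ.+-mono-≤-< (0≤f (here refl)) (∑-pos (0≤f ∘ there) y∈ 0<fy)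

∑-unique : ∀ {xs : List A} {f : A → ℤ} {y} → Unique xs → y ∈ˡ xs → (∀ x → x ≢ y → f x ≡ 0ℤ) → ∑ xs f ≡ f y
∑-unique {xs = _ ∷ xs} {f} {y} (y∉ ∷ _) (here refl) f≡0 =
  trans (cong (f y +ᶻ_) (∑-zero xs λ x∈ → f≡0 _ λ x≡y → All.lookup y∉ x∈ (sym x≡y))) (ℤ.+-identityʳ _)
∑-unique {y = y} (x∉ ∷ u) (there y∈) f≡0 =
  trans (cong₂ _+ᶻ_ (f≡0 _ (All.lookup x∉ y∈)) (∑-unique u y∈ f≡0)) (ℤ.+-identityˡ _)

-- Signed sums over all subsets

sgn : ℕ → ℤ
sgn m = -1ℤ ℤ.^ m

sgn-square : ∀ m → sgn m *ᶻ sgn m ≡ 1ℤ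
sgn-square zero    = refl
sgn-square (suc m) = begin
  (-1ℤ *ᶻ sgn m) *ᶻ (-1ℤ *ᶻ sgn m)  ≡⟨ cong₂ _*ᶻ_ (ℤ.-1*i≡-i (sgn m)) (ℤ.-1*i≡-i (sgn m)) ⟩
  (ℤ.- sgn m) *ᶻ (ℤ.- sgn m)          ≡⟨ ℤ.neg-distribˡ-* (sgn m) (ℤ.- sgn m) ⟨
  ℤ.- (sgn m *ᶻ ℤ.- sgn m)            ≡⟨ cong ℤ.-_ (ℤ.neg-distribʳ-* (sgn m) (sgn m)) ⟨
  ℤ.- (ℤ.- (sgn m *ᶻ sgn m))          ≡⟨ ℤ.neg-involutive _ ⟩
  sgn m *ᶻ sgn m                      ≡⟨ sgn-square m ⟩
  1ℤ                                   ∎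
  where open ≡-Reasoning

signedSum : List A → (List A → ℤ) → ℤ
signedSum xs f = ∑ (subsets xs) λ S → sgn (length S) *ᶻ f S

-- The subsets split by whether they take `x`; taking it lengthens a subset by one, which flips its
-- sign.
signedSum-∷ : ∀ (x : A) xs f → signedSum (x ∷ xs) f ≡ signedSum xs f ℤ.- signedSum xs (f ∘ (x ∷_))
signedSum-∷ x xs f = begin
  ∑ (subsets xs ++ map (x ∷_) (subsets xs)) term
    ≡⟨ ∑-++ (subsets xs) _ term ⟩
  signedSum xs f +ᶻ ∑ (map (x ∷_) (subsets xs)) term
    ≡⟨ cong (λ ts → signedSum xs f +ᶻ sumℤ ts) (sym (List.map-∘ (subsets xs))) ⟩
  signedSum xs f +ᶻ ∑ (subsets xs) (term ∘ (x ∷_))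
    ≡⟨ cong (signedSum xs f +ᶻ_) (∑-cong (subsets xs) λ {S} _ → ℤ.*-assoc -1ℤ (sgn (length S)) _) ⟩
  signedSum xs f +ᶻ ∑ (subsets xs) (λ S → -1ℤ *ᶻ (sgn (length S) *ᶻ f (x ∷ S)))
    ≡⟨ cong (signedSum xs f +ᶻ_) (∑-*ˡ -1ℤ (subsets xs) _) ⟨
  signedSum xs f +ᶻ -1ℤ *ᶻ signedSum xs (f ∘ (x ∷_))
    ≡⟨ cong (signedSum xs f +ᶻ_) (ℤ.-1*i≡-i _) ⟩
  signedSum xs f ℤ.- signedSum xs (f ∘ (x ∷_)) ∎
  where
  open ≡-Reasoning
  term : List _ → ℤ
  term S = sgn (length S) *ᶻ f S

-- Subsets are compared by membership and not as lists: `H [ S ]` depends on `S` only through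
-- membership, and the relation survives consing a common head.
AgreeOff : A → List A → List A → Set
AgreeOff e S S′ = ∀ a → a ≢ e → a ∈ˡ S ⇔ a ∈ˡ S′

-- Toggling `e` is a sign-reversing involution. In the recursion, if `e` is the head, the two halves
-- of `signedSum-∷` coincide; if it lies deeper, both halves vanish.
signedSum-vanishes : ∀ {e : A} {xs} (f : List A → ℤ) → e ∈ˡ xs →
                     (∀ S S′ → AgreeOff e S S′ → f S ≡ f S′) → signedSum xs f ≡ 0ℤ
signedSum-vanishes {e = e} {x ∷ xs} f e∈ resp = trans (signedSum-∷ x xs f) (split e∈)
  where
  split : e ∈ˡ x ∷ xs → signedSum xs f ℤ.- signedSum xs (f ∘ (x ∷_)) ≡ 0ℤ
  split (here refl) = ℤ.i≡j⇒i-j≡0 (∑-cong (subsets xs) λ {S} _ →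
    cong (sgn (length S) *ᶻ_) (resp S (x ∷ S) λ a a≢e →
      mk⇔ there λ { (here a≡e) → contradiction a≡e a≢e ; (there a∈) → a∈ }))
  split (there e∈′) = cong₂ ℤ._-_ (signedSum-vanishes f e∈′ resp)
    (signedSum-vanishes (f ∘ (x ∷_)) e∈′ λ S S′ agree → resp (x ∷ S) (x ∷ S′) λ a a≢e →
      let open Equivalence (agree a a≢e) in
      mk⇔ (λ { (here p) → here p ; (there p) → there (to p) })
          (λ { (here p) → here p ; (there p) → there (from p) }))

∈-subsets⇒⊆ : ∀ (xs : List A) {S x} → S ∈ˡ subsets xs → x ∈ˡ S → x ∈ˡ xs
∈-subsets⇒⊆ []       (here refl) ()
∈-subsets⇒⊆ (y ∷ xs) S∈ x∈ with ∈-++⁻ (subsets xs) S∈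
... | inj₁ S∈′ = there (∈-subsets⇒⊆ xs S∈′ x∈)
... | inj₂ S∈′ with ∈-map⁻ (y ∷_) S∈′
...   | S′ , S′∈ , refl with x∈
...     | here x≡y = here x≡y
...     | there x∈′ = there (∈-subsets⇒⊆ xs S′∈ x∈′)

∈-subsets⇒unique : ∀ {xs : List A} {S} → Unique xs → S ∈ˡ subsets xs → Unique S
∈-subsets⇒unique {xs = []}     _        (here refl) = []
∈-subsets⇒unique {xs = y ∷ xs} (y∉ ∷ u) S∈ with ∈-++⁻ (subsets xs) S∈
... | inj₁ S∈′ = ∈-subsets⇒unique u S∈′
... | inj₂ S∈′ with ∈-map⁻ (y ∷_) S∈′
...   | S′ , S′∈ , refl =
        All.tabulate (λ x∈ → All.lookup y∉ (∈-subsets⇒⊆ xs S′∈ x∈)) ∷ ∈-subsets⇒unique u S′∈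

-- `subsets xs` holds only sublists in the order of `xs`, so an explicit edge set is supplied as a
-- filter.
filter∈subsets : ∀ {P : A → Set} (P? : ∀ x → Dec (P x)) xs → filter P? xs ∈ˡ subsets xs
filter∈subsets P? [] = here refl
filter∈subsets P? (x ∷ xs) with does (P? x)
... | true  = ∈-++⁺ʳ (subsets xs) (∈-map⁺ (x ∷_) (filter∈subsets P? xs))
... | false = ∈-++⁺ˡ (filter∈subsets P? xs)

-- Finite sets of vertices

isLeg? : (Q : Vec (Fin n) m) (v : Fin n) → Dec (IsLeg Q v)
isLeg? Q v = Fin.all? λ i → ¬? (lookup Q i Fin.≟ v)

onSpine? : (Q : Vec (Fin n) m) (v : Fin n) → (∃[ i ] lookup Q i ≡ v) ⊎ IsLeg Q v
onSpine? Q v with Fin.any? (λ i → lookup Q i Fin.≟ v)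
... | yes on = inj₁ on
... | no off = inj₂ λ i eq → off (i , eq)

-- Pigeonhole: without legs, choosing a position in `Q` for every vertex would inject `Fin n` into
-- `Fin m`.
exists-leg : m < n → (Q : Vec (Fin n) m) → ∃ (IsLeg Q)
exists-leg {m} {n} m<n Q with Fin.any? (isLeg? Q)
... | yes leg = leg
... | no none = contradiction (Fin.injective⇒≤ {f = proj₁ ∘ index} index-inj) (ℕ.<⇒≱ m<n)
  where
  index : ∀ v → ∃[ i ] lookup Q i ≡ v
  index v = [ id , (λ leg → contradiction (v , leg) none) ]′ (onSpine? Q v)
  index-inj : Injective _≡_ _≡_ (proj₁ ∘ index)
  index-inj {u} {v} eq = trans (sym (proj₂ (index u))) (trans (cong (lookup Q) eq) (proj₂ (index v)))

members : Vec (Fin n) m → Subset n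
members []      = ⊥
members (v ∷ Q) = members Q [ v ]≔ inside

∣insert∣ : (p : Subset n) (v : Fin n) → ∣ p [ v ]≔ inside ∣ ≤ suc ∣ p ∣
∣insert∣ (outside ∷ p) zero    = ℕ.≤-refl
∣insert∣ (inside  ∷ p) zero    = ℕ.n≤1+n _
∣insert∣ (outside ∷ p) (suc v) = ∣insert∣ p v
∣insert∣ (inside  ∷ p) (suc v) = s≤s (∣insert∣ p v)

-- Only an inequality, since entries may repeat: the upper bound applies this to arbitrary tuples,
-- not just to scorpion tuples.
∣members∣≤ : (Q : Vec (Fin n) m) → ∣ members Q ∣ ≤ m
∣members∣≤ {n} []  = ℕ.≤-reflexive (∣⊥∣≡0 n)
∣members∣≤ (v ∷ Q) = ℕ.≤-trans (∣insert∣ (members Q) v) (s≤s (∣members∣≤ Q))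

lookup∈members : (Q : Vec (Fin n) m) (i : Fin m) → lookup Q i ∈ members Q
lookup∈members (v ∷ Q) zero = Vec.lookup⇒[]= v _ (Vec.lookup∘update v (members Q) inside)
lookup∈members (v ∷ Q) (suc i) with lookup Q i Fin.≟ v
... | yes eq = subst (_∈ members (v ∷ Q)) (sym eq) (lookup∈members (v ∷ Q) zero)
... | no neq = Vec.[]≔-minimal (members Q) (lookup Q i) v neq (lookup∈members Q i)

-- The position of `v` among the elements of `p`; it lets injections between `Fin` types bound
-- cardinalities of subsets.
rank : ∀ {p : Subset n} {v} → v ∈ p → Fin ∣ p ∣
rank {p = inside  ∷ p} hereᵛ      = zero
rank {p = inside  ∷ p} (thereᵛ v∈) = suc (rank v∈)
rank {p = outside ∷ p} (thereᵛ v∈) = rank v∈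

rank-injective : ∀ {p : Subset n} {u v} (u∈ : u ∈ p) (v∈ : v ∈ p) → rank u∈ ≡ rank v∈ → u ≡ v
rank-injective {p = inside  ∷ p} hereᵛ       hereᵛ       eq = refl
rank-injective {p = inside  ∷ p} (thereᵛ u∈) (thereᵛ v∈) eq = cong suc (rank-injective u∈ v∈ (Fin.suc-injective eq))
rank-injective {p = outside ∷ p} (thereᵛ u∈) (thereᵛ v∈) eq = cong suc (rank-injective u∈ v∈ eq)

injection-into⇒≤ : ∀ {p : Subset n} {f : Fin m → Fin n} → Injective _≡_ _≡_ f → (∀ i → f i ∈ p) → m ≤ ∣ p ∣
injection-into⇒≤ f-inj f∈ = Fin.injective⇒≤ {f = rank ∘ f∈} λ {i} {j} eq → f-inj (rank-injective (f∈ i) (f∈ j) eq)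

-- Uniqueness of the scorpion tuple

Tuple : ℕ → ℕ → Set
Tuple n ℓ = Fin n × Vec (Fin n) ℓ × Fin n

spine : Tuple n ℓ → Vec (Fin n) (2 + ℓ)
spine (b , t , s) = b ∷ (t ∷ʳ s)

IsTuple : Graph n → Tuple n ℓ → Set
IsTuple G (b , t , s) = IsScorpionTuple G b t s

isTuple? : (G : Graph n) (q : Tuple n ℓ) → Dec (IsTuple G q)
isTuple? G (b , t , s) = isScorpionTuple? G b t s

spine-injective : (q q′ : Tuple n ℓ) → (∀ i → lookup (spine q) i ≡ lookup (spine q′) i) → q ≡ q′
spine-injective q@(b , t , s) q′@(b′ , t′ , s′) eq
  with refl , tail-eq ← Vec.∷-injective (trans (sym (Vec.tabulate∘lookup (spine q)))
         (trans (Vec.tabulate-cong eq) (Vec.tabulate∘lookup (spine q′))))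
  with refl , refl ← Vec.∷ʳ-injective t t′ tail-eq = refl

Adj-sym : (G : Graph n) {u v : Fin n} → Adj G u v → Adj G v u
Adj-sym G {u} {v} = subst T (adj-sym G u v)

-- An index has at most one successor and one predecessor, so two of three path neighbours collide.
consecutive-three : {i j₁ j₂ j₃ : Fin m} → Consecutive i j₁ → Consecutive i j₂ → Consecutive i j₃ →
                    j₁ ≡ j₂ ⊎ j₁ ≡ j₃ ⊎ j₂ ≡ j₃
consecutive-three (inj₁ p) (inj₁ q) _        = inj₁ (Fin.toℕ-injective (trans (sym p) q))
consecutive-three (inj₁ p) (inj₂ _) (inj₁ q) = inj₂ (inj₁ (Fin.toℕ-injective (trans (sym p) q)))
consecutive-three (inj₂ p) (inj₁ _) (inj₂ q) = inj₂ (inj₁ (Fin.toℕ-injective (ℕ.suc-injective (trans p (sym q)))))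
consecutive-three (inj₂ p) (inj₂ q) _        = inj₁ (Fin.toℕ-injective (ℕ.suc-injective (trans p (sym q))))
consecutive-three (inj₁ _) (inj₂ p) (inj₂ q) = inj₂ (inj₂ (Fin.toℕ-injective (ℕ.suc-injective (trans p (sym q)))))
consecutive-three (inj₂ _) (inj₁ p) (inj₁ q) = inj₂ (inj₂ (Fin.toℕ-injective (trans (sym p) q)))

module ScorpionTuple (G : Graph n) (q : Tuple n ℓ) (r : IsTuple G q) where
  open IsScorpionTuple r public

  Q : Vec (Fin n) (2 + ℓ)
  Q = spine q

  b : Fin n
  b = proj₁ q

  Q-suc-neighbour : ∀ {i v} → Adj G (lookup Q (suc i)) v → ∃[ j ] (lookup Q j ≡ v × Consecutive (suc i) j)
  Q-suc-neighbour {i} {v} a with onSpine? Q v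
  ... | inj₁ (j , refl) = j , refl , Equivalence.to (inducedPath (suc i) j) a
  ... | inj₂ leg with () ← distinct (suc i) zero (only-b (suc i) v leg a)

  leg-neighbour : ∀ {u v} → IsLeg Q u → Adj G u v → v ≡ b ⊎ IsLeg Q v
  leg-neighbour {u} {v} leg a with onSpine? Q v
  ... | inj₁ (j , refl) = inj₁ (only-b j u leg (Adj-sym G a))
  ... | inj₂ leg′ = inj₂ leg′

  -- Since `b` sees all legs and the next spine vertex, only the spine positions from 2 on remain,
  -- and there are `ℓ` of them.
  b-nonneighbour : ∀ {v} → v ≢ b → ¬ Adj G b v → ∃[ j ] lookup Q (suc (suc j)) ≡ v
  b-nonneighbour {v} v≢b ¬a with onSpine? Q v
  ... | inj₁ (zero , eq)        = contradiction (sym eq) v≢b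
  ... | inj₁ (suc zero , refl)  = contradiction (Equivalence.from (inducedPath zero (suc zero)) (inj₁ refl)) ¬a
  ... | inj₁ (suc (suc j) , eq) = j , eq
  ... | inj₂ leg                = contradiction (b-legs v leg) ¬a

  b-second : ∀ {j} → ¬ Adj G b (lookup Q (suc (suc j)))
  b-second {j} a with Equivalence.to (inducedPath zero (suc (suc j))) a
  ... | inj₁ ()
  ... | inj₂ ()

module _ {G : Graph n} {q q′ : Tuple n ℓ} (r : IsTuple G q) (r′ : IsTuple G q′) where
  private
    module R  = ScorpionTuple G q r
    module R′ = ScorpionTuple G q′ r′

  b-unique : ℓ + 4 ≤ n → R.b ≡ R′.b
  b-unique ℓ+4≤n with onSpine? R.Q R′.b
  ... | inj₁ (zero , eq) = eq
  ... | inj₁ (suc i , eq) = contradiction three-neighbours λ { (a₁ , a₂ , a₃) → collide a₁ a₂ a₃ }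
    where
    -- b′ has a third neighbour besides the two that an inner vertex of a path can have.
    4+ℓ≤n : 4 + ℓ ≤ n
    4+ℓ≤n = subst (_≤ n) (ℕ.+-comm ℓ 4) ℓ+4≤n
    x,leg = exists-leg (ℕ.≤-trans (ℕ.n≤1+n _) 4+ℓ≤n) R′.Q
    x = proj₁ x,leg
    -- Avoiding `x` together with the spine makes the second leg differ from the first; this is
    -- where all `ℓ + 4` vertices are used.
    y,leg = exists-leg 4+ℓ≤n (x ∷ R′.Q)
    y = proj₁ y,leg
    z = lookup R′.Q (suc zero)
    three-neighbours : Adj G R′.b x × Adj G R′.b y × Adj G R′.b z
    three-neighbours = R′.b-legs x (proj₂ x,leg) , R′.b-legs y (proj₂ y,leg ∘ suc)
      , Equivalence.from (R′.inducedPath zero (suc zero)) (inj₁ refl)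
    collide : Adj G R′.b x → Adj G R′.b y → Adj G R′.b z → _
    collide a₁ a₂ a₃
      with j₁ , e₁ , c₁ ← R.Q-suc-neighbour {i} (subst (λ u → Adj G u x) (sym eq) a₁)
         | j₂ , e₂ , c₂ ← R.Q-suc-neighbour {i} (subst (λ u → Adj G u y) (sym eq) a₂)
         | j₃ , e₃ , c₃ ← R.Q-suc-neighbour {i} (subst (λ u → Adj G u z) (sym eq) a₃)
      with consecutive-three c₁ c₂ c₃
    ... | inj₁ refl        = proj₂ y,leg zero (trans (sym e₁) e₂)
    ... | inj₂ (inj₁ refl) = proj₂ x,leg (suc zero) (trans (sym e₃) e₁)
    ... | inj₂ (inj₂ refl) = proj₂ y,leg (suc (suc zero)) (trans (sym e₃) e₂)
  -- A leg b′ would miss the ℓ + 1 vertices t₁ , … , s, but it has only ℓ non-neighbours.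
  ... | inj₂ leg = contradiction (Fin.injective⇒≤ {f = proj₁ ∘ missed} missed-injective) ℕ.1+n≰n
    where
    missed : ∀ i → ∃[ j ] lookup R′.Q (suc (suc j)) ≡ lookup R.Q (suc i)
    missed i = R′.b-nonneighbour (leg (suc i))
      λ a → case R.distinct (suc i) zero (R.only-b (suc i) R′.b leg (Adj-sym G a)) of λ ()
    missed-injective : Injective _≡_ _≡_ (proj₁ ∘ missed)
    missed-injective {i} {j} eq = Fin.suc-injective (R.distinct (suc i) (suc j)
      (trans (sym (proj₂ (missed i))) (trans (cong (λ k → lookup R′.Q (suc (suc k))) eq) (proj₂ (missed j)))))

module _ {G : Graph n} {q q′ : Tuple n (suc ℓ)} (r : IsTuple G q) (r′ : IsTuple G q′) where
  private
    module R  = ScorpionTuple G q r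
    module R′ = ScorpionTuple G q′ r′

  -- The first inner vertex of `q′` is a neighbour of the common `b`, so on the spine of `q` it must
  -- have index 1. If it were a leg of `q` instead, its successor in `q′` would be `b` or again a
  -- leg of `q`, hence equal or adjacent to `b`; a vertex at position 2 of `q′` is neither. The type
  -- `suc ℓ` ensures that position 2 exists.
  t₁-unique : R.b ≡ R′.b → lookup R.Q (suc zero) ≡ lookup R′.Q (suc zero)
  t₁-unique b≡b′ with onSpine? R.Q (lookup R′.Q (suc zero))
  ... | inj₁ (j , eq)
      with Equivalence.to (R.inducedPath zero j)
             (subst₂ (Adj G) (sym b≡b′) (sym eq) (Equivalence.from (R′.inducedPath zero (suc zero)) (inj₁ refl)))
  ...   | inj₁ 1≡j = trans (cong (lookup R.Q) (Fin.toℕ-injective 1≡j)) eq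
  ...   | inj₂ ()
  t₁-unique b≡b′ | inj₂ leg
      with R.leg-neighbour leg (Equivalence.from (R′.inducedPath (suc zero) (suc (suc zero))) (inj₁ refl))
  ...   | inj₁ t₂≡b = case R′.distinct (suc (suc zero)) zero (trans t₂≡b b≡b′) of λ ()
  ...   | inj₂ leg₂ = contradiction (subst (λ u → Adj G u _) b≡b′ (R.b-legs _ leg₂)) R′.b-second

-- Once `b` and the first inner vertex agree, the path has no choice: each next vertex is the
-- neighbour that was not visited just before. The bound `d` makes the induction reach back two
-- positions.
tuple-unique : {G : Graph n} {q q′ : Tuple n ℓ} → 1 ≤ ℓ → ℓ + 4 ≤ n → IsTuple G q → IsTuple G q′ → q ≡ q′
tuple-unique {n} {ℓ = suc ℓ} {G} {q} {q′} (s≤s z≤n) ℓ+4≤n r r′ = spine-injective q q′ λ i → agree (toℕ i) i ℕ.≤-refl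
  where
  module R  = ScorpionTuple G q r
  module R′ = ScorpionTuple G q′ r′

  agree : ∀ d i → toℕ i ≤ d → lookup R.Q i ≡ lookup R′.Q i
  agree _       zero          _ = b-unique {q = q} {q′} r r′ ℓ+4≤n
  agree _       (suc zero)    _ = t₁-unique {q = q} {q′} r r′ (b-unique {q = q} {q′} r r′ ℓ+4≤n)
  agree (suc d) (suc (suc i)) (s≤s i<d)
    with j , eq , c ← R′.Q-suc-neighbour {inject₁ i} {lookup R.Q (suc (suc i))}
           (subst (λ u → Adj G u _) (agree d (suc (inject₁ i)) (subst (λ k → suc k ≤ d) (sym (Fin.toℕ-inject₁ i)) i<d))
             (Equivalence.from (R.inducedPath (suc (inject₁ i)) (suc (suc i))) (inj₁ (cong (2 +_) (Fin.toℕ-inject₁ i)))))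
    with c
  ... | inj₁ up = trans (sym eq) (cong (lookup R′.Q) (Fin.toℕ-injective (trans (sym up) (cong (2 +_) (Fin.toℕ-inject₁ i)))))
  -- Stepping back in `q′` would land on position `i`, where both tuples already agree, so `q` would
  -- repeat a vertex at positions `i` and `i + 2`.
  ... | inj₂ down = contradiction (cong toℕ j≡i+2) λ j≡i+2 → ℕ.m≢1+n+m (toℕ i) (trans (sym toℕj≡i) j≡i+2)
    where
    toℕj≡i : toℕ j ≡ toℕ i
    toℕj≡i = trans (ℕ.suc-injective down) (Fin.toℕ-inject₁ i)
    j≡i+2 : j ≡ suc (suc i)
    j≡i+2 = R.distinct j (suc (suc i)) (trans (agree d j (ℕ.≤-trans (ℕ.≤-reflexive toℕj≡i) (ℕ.<⇒≤ i<d))) eq)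

-- Expansion of the enumerator over tuples

allVecs : ∀ n m → List (Vec (Fin n) m)
allVecs n zero    = [] ∷ []
allVecs n (suc m) = cartesianProductWith _∷_ (allFin n) (allVecs n m)

allVecs-unique : ∀ n m → Unique (allVecs n m)
allVecs-unique n zero    = [] ∷ []
allVecs-unique n (suc m) = Unique.cartesianProductWith⁺ _∷_ Vec.∷-injective (Unique.allFin⁺ n) (allVecs-unique n m)

∈-allVecs : (v : Vec (Fin n) m) → v ∈ˡ allVecs n m
∈-allVecs []      = here refl
∈-allVecs (x ∷ v) = ∈-cartesianProductWith⁺ _∷_ (∈-allFin x) (∈-allVecs v)

allTuples : ∀ n ℓ → List (Tuple n ℓ)
allTuples n ℓ = cartesianProduct (allFin n) (cartesianProduct (allVecs n ℓ) (allFin n))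

allTuples-unique : ∀ n ℓ → Unique (allTuples n ℓ)
allTuples-unique n ℓ = Unique.cartesianProduct⁺ (Unique.allFin⁺ n)
  (Unique.cartesianProduct⁺ (allVecs-unique n ℓ) (Unique.allFin⁺ n))

∈-allTuples : (q : Tuple n ℓ) → q ∈ˡ allTuples n ℓ
∈-allTuples (b , t , s) = ∈-cartesianProduct⁺ (∈-allFin b) (∈-cartesianProduct⁺ (∈-allVecs t) (∈-allFin s))

tupleIndicator : Graph n → Tuple n ℓ → ℤ
tupleIndicator G q = indicator (does (isTuple? G q))

tupleIndicator-true : (G : Graph n) (q : Tuple n ℓ) → IsTuple G q → tupleIndicator G q ≡ 1ℤ
tupleIndicator-true G q r = cong indicator (dec-true (isTuple? G q) r)

tupleIndicator-false : (G : Graph n) (q : Tuple n ℓ) → ¬ IsTuple G q → tupleIndicator G q ≡ 0ℤ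
tupleIndicator-false G q ¬r = cong indicator (dec-false (isTuple? G q) ¬r)

-- By uniqueness at most one summand is 1, so summing over candidate tuples counts no scorpion
-- twice.
indicator-Ψ : 1 ≤ ℓ → ℓ + 4 ≤ n → (G : Graph n) →
              indicator (holds (Ψ ℓ) G) ≡ ∑ (allTuples n ℓ) (tupleIndicator G)
indicator-Ψ {ℓ} {n} 1≤ℓ ℓ+4≤n G = case isScorpion? ℓ G of λ where
  (yes sc@(_ , b , t , s , r)) → trans (cong indicator (dec-true (isScorpion? ℓ G) sc)) (sym
    (trans (∑-unique (allTuples-unique n ℓ) (∈-allTuples (b , t , s))
             λ q q≢ → tupleIndicator-false G q λ r′ → q≢ (tuple-unique 1≤ℓ ℓ+4≤n r′ r))
           (tupleIndicator-true G (b , t , s) r)))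
  (no ¬sc) → trans (cong indicator (dec-false (isScorpion? ℓ G) ¬sc)) (sym
    (∑-zero (allTuples n ℓ) λ { {b , t , s} _ → tupleIndicator-false G (b , t , s) λ r → ¬sc (ℓ+4≤n , b , t , s , r) }))

tupleSum : Graph n → Tuple n ℓ → ℤ
tupleSum H q = signedSum (edges H) λ S → tupleIndicator (H [ S ]) q

-- Exchanging the sums over edge sets and over tuples allows each tuple to be treated on its own.
enumerator-Ψ : 1 ≤ ℓ → ℓ + 4 ≤ n → (H : Graph n) →
               alternatingEnumerator (Ψ ℓ) H ≡ sgn (length (edges H)) *ᶻ ∑ (allTuples n ℓ) (tupleSum H)
enumerator-Ψ {ℓ} {n} 1≤ℓ ℓ+4≤n H = cong (sgn (length (edges H)) *ᶻ_) (trans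
  (∑-cong (subsets (edges H)) λ {S} _ → trans
    (cong (sgn (length S) *ᶻ_) (indicator-Ψ 1≤ℓ ℓ+4≤n (H [ S ])))
    (∑-*ˡ (sgn (length S)) (allTuples n ℓ) _))
  (∑-swap (subsets (edges H)) (allTuples n ℓ) _))

-- Edges between legs

∈-edges⁻ : (H : Graph n) {u v : Fin n} → (u , v) ∈ˡ edges H → u Fin.< v × Adj H u v
∈-edges⁻ {n} H e∈ = proj₂ (∈-filter⁻ (λ (u , v) → (u Fin.<? v) ×-dec T? (adj H u v))
  {xs = cartesianProduct (allFin n) (allFin n)} e∈)

∈-edges⁺ : (H : Graph n) {u v : Fin n} → u Fin.< v → Adj H u v → (u , v) ∈ˡ edges H
∈-edges⁺ H u<v a = ∈-filter⁺ (λ (u , v) → (u Fin.<? v) ×-dec T? (adj H u v))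
  (∈-cartesianProduct⁺ (∈-allFin _) (∈-allFin _)) (u<v , a)

edges-unique : (H : Graph n) → Unique (edges H)
edges-unique {n} H = Unique.filter⁺ _ (Unique.cartesianProduct⁺ (Unique.allFin⁺ n) (Unique.allFin⁺ n))

T-does⁻ : (a? : Dec A) → T (does a?) → A
T-does⁻ (yes a) _ = a

T-does⁺ : (a? : Dec A) → A → T (does a?)
T-does⁺ a? a = Equivalence.from T-≡ (dec-true a? a)

adj-[]⁺ : (H : Graph n) (S : List (Edge n)) {u v : Fin n} → Adj H u v → (u , v) ∈ˡ S → Adj (H [ S ]) u v
adj-[]⁺ H S {u} {v} a e∈ = subst T (sym (cong₂ (λ x y → x ∧ (y ∨ does (member? _≟ᴱ_ (v , u) S)))
  (Equivalence.to T-≡ a) (dec-true (member? _≟ᴱ_ (u , v) S) e∈))) _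

adj-[]⁻ : (H : Graph n) (S : List (Edge n)) {u v : Fin n} →
          Adj (H [ S ]) u v → Adj H u v × ((u , v) ∈ˡ S ⊎ (v , u) ∈ˡ S)
adj-[]⁻ H S {u} {v} a with aH , aS ← Equivalence.to T-∧ a =
  aH , Sum.map (T-does⁻ (member? _≟ᴱ_ (u , v) S)) (T-does⁻ (member? _≟ᴱ_ (v , u) S)) (Equivalence.to T-∨ aS)

-- Every scorpion condition on adjacency concerns a pair with an end on the spine; pairs of legs are
-- unconstrained.
isTuple-resp : (G G′ : Graph n) (q : Tuple n ℓ) →
               (∀ i v → adj G (lookup (spine q) i) v ≡ adj G′ (lookup (spine q) i) v) →
               IsTuple G q → IsTuple G′ q
isTuple-resp G G′ q eq r = record
  { distinct    = distinct
  ; inducedPath = λ i j → mk⇔ (Equivalence.to (inducedPath i j) ∘ subst T (sym (eq i _)))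
                              (subst T (eq i _) ∘ Equivalence.from (inducedPath i j))
  ; b-legs      = λ v leg → subst T (eq zero v) (b-legs v leg)
  ; only-b      = λ i v leg → only-b i v leg ∘ subst T (sym (eq i v))
  }
  where open IsScorpionTuple r

tupleIndicator-resp : (G G′ : Graph n) (q : Tuple n ℓ) →
                      (∀ i v → adj G (lookup (spine q) i) v ≡ adj G′ (lookup (spine q) i) v) →
                      tupleIndicator G q ≡ tupleIndicator G′ q
tupleIndicator-resp G G′ q eq = cong indicator (does-⇔
  (mk⇔ (isTuple-resp G G′ q eq) (isTuple-resp G′ G q λ i v → sym (eq i v))) (isTuple? G q) (isTuple? G′ q))

-- Toggling an edge between legs does not affect the scorpion conditions, so the signs cancel.
tupleSum-vanishes : (H : Graph n) (q : Tuple n ℓ) {u v : Fin n} →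
                    IsLeg (spine q) u → IsLeg (spine q) v → Adj H u v → tupleSum H q ≡ 0ℤ
tupleSum-vanishes {n} H q {u} {v} u-leg v-leg a = case Fin.<-cmp u v of λ where
    (tri< u<v _ _)  → vanish u-leg v-leg u<v a
    (tri≈ _ refl _) → case subst T (adj-irrefl H u) a of λ ()
    (tri> _ _ v<u)  → vanish v-leg u-leg v<u (Adj-sym H a)
  where
  vanish : ∀ {x y} → IsLeg (spine q) x → IsLeg (spine q) y → x Fin.< y → Adj H x y → tupleSum H q ≡ 0ℤ
  vanish {x} {y} x-leg y-leg x<y xy = signedSum-vanishes {e = x , y} (λ S → tupleIndicator (H [ S ]) q) (∈-edges⁺ H x<y xy) λ S S′ agree →
    -- A pair with a spine vertex in either place differs from `(x , y)`, as both `x` and `y` are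
    -- legs, so both membership tests are unaffected by the toggle.
    tupleIndicator-resp (H [ S ]) (H [ S′ ]) q λ i w → cong (adj H (lookup (spine q) i) w ∧_) (cong₂ _∨_
      (does-⇔ (agree _ (x-leg i ∘ cong proj₁)) (member? _≟ᴱ_ (lookup (spine q) i , w) S) (member? _≟ᴱ_ (lookup (spine q) i , w) S′))
      (does-⇔ (agree _ (y-leg i ∘ cong proj₂)) (member? _≟ᴱ_ (w , lookup (spine q) i) S) (member? _≟ᴱ_ (w , lookup (spine q) i) S′)))

-- Independent legs and the upper bound on the vertex-cover number

LegsIndependent : Graph n → Vec (Fin n) m → Set
LegsIndependent H Q = ∀ {u v} → IsLeg Q u → IsLeg Q v → ¬ Adj H u v

legEdge? : (H : Graph n) (Q : Vec (Fin n) m) →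
           (∃[ u ] ∃[ v ] (IsLeg Q u × IsLeg Q v × Adj H u v)) ⊎ LegsIndependent H Q
legEdge? H Q with Fin.any? (λ u → Fin.any? (λ v → isLeg? Q u ×-dec isLeg? Q v ×-dec T? (adj H u v)))
... | yes edge = inj₁ edge
... | no none  = inj₂ λ lu lv a → none (_ , _ , lu , lv , a)

independentLegs⇒cover : (H : Graph n) (Q : Vec (Fin n) m) → LegsIndependent H Q → IsVertexCover H (members Q)
independentLegs⇒cover H Q indep u v a with onSpine? Q u | onSpine? Q v
... | inj₁ (i , refl) | _               = inj₁ (lookup∈members Q i)
... | inj₂ _          | inj₁ (j , refl) = inj₂ (lookup∈members Q j)
... | inj₂ u-leg      | inj₂ v-leg      = contradiction a (indep u-leg v-leg)

vertexCoverNumber-≤ : (H : Graph n) {C : Subset n} → IsVertexCover H C → vertexCoverNumber H ≤ ∣ C ∣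
vertexCoverNumber-≤ H {C} cover = proj₂ (proj₂ (leastCoverSize H)) ∣ C ∣ (C , cover , refl)

enumerator≢0⇒cover≤ : 1 ≤ ℓ → ℓ + 4 ≤ n → (H : Graph n) →
                      alternatingEnumerator (Ψ ℓ) H ≢ 0ℤ → vertexCoverNumber H ≤ ℓ + 2
enumerator≢0⇒cover≤ {ℓ} {n} 1≤ℓ ℓ+4≤n H ≢0 =
  -- If the cover number exceeded `ℓ + 2`, no spine could be a cover, so every tuple would have an
  -- edge between legs and contribute zero.
  decidable-stable (vertexCoverNumber H ≤? ℓ + 2) λ ≰ℓ+2 → contradiction
    (trans (enumerator-Ψ 1≤ℓ ℓ+4≤n H) (trans
      (cong (sgn (length (edges H)) *ᶻ_) (∑-zero (allTuples n ℓ) λ {q} _ → all-vanish ≰ℓ+2 q))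
      (ℤ.*-zeroʳ (sgn (length (edges H))))))
    ≢0
  where
  all-vanish : ¬ vertexCoverNumber H ≤ ℓ + 2 → (q : Tuple n ℓ) → tupleSum H q ≡ 0ℤ
  all-vanish ≰ℓ+2 q = case legEdge? H (spine q) of λ where
    (inj₁ (_ , _ , u-leg , v-leg , a)) → tupleSum-vanishes H q u-leg v-leg a
    (inj₂ indep) → contradiction
      (ℕ.≤-trans (vertexCoverNumber-≤ H (independentLegs⇒cover H (spine q) indep))
        (subst (∣ members (spine q) ∣ ≤_) (ℕ.+-comm 2 ℓ) (∣members∣≤ (spine q))))
      ≰ℓ+2

-- Scorpions with independent legs are trees

-- For distinct ends this is the orientation that `edges` stores, so parent edges can be compared
-- with members of `S`.
sortEdge : Fin n → Fin n → Edge n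
sortEdge u v = if does (u Fin.<? v) then (u , v) else (v , u)

sortEdge-< : {u v : Fin n} → u Fin.< v → sortEdge u v ≡ (u , v)
sortEdge-< {u = u} {v} u<v = cong (if_then (u , v) else (v , u)) (dec-true (u Fin.<? v) u<v)

sortEdge-> : {u v : Fin n} → v Fin.< u → sortEdge u v ≡ (v , u)
sortEdge-> {u = u} {v} v<u = cong (if_then (u , v) else (v , u)) (dec-false (u Fin.<? v) (Fin.<-asym v<u))

sortEdge-cases : (u v : Fin n) → sortEdge u v ≡ (u , v) ⊎ sortEdge u v ≡ (v , u)
sortEdge-cases u v with does (u Fin.<? v)
... | true  = inj₁ refl
... | false = inj₂ refl

sortEdge-injective : {u v x y : Fin n} → sortEdge u v ≡ sortEdge x y → (u ≡ x × v ≡ y) ⊎ (u ≡ y × v ≡ x)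
sortEdge-injective {u = u} {v} {x} {y} eq with sortEdge-cases u v | sortEdge-cases x y
... | inj₁ p | inj₁ q = inj₁ (Product.,-injective (trans (sym p) (trans eq q)))
... | inj₁ p | inj₂ q = inj₂ (Product.,-injective (trans (sym p) (trans eq q)))
... | inj₂ p | inj₁ q = inj₂ (swap (Product.,-injective (trans (sym p) (trans eq q))))
... | inj₂ p | inj₂ q = inj₁ (swap (Product.,-injective (trans (sym p) (trans eq q))))

module TreeEdges (H : Graph (suc n)) {S : List (Edge (suc n))} (S∈ : S ∈ˡ subsets (edges H))
                 (q : Tuple (suc n) ℓ) (r : IsTuple (H [ S ]) q) (indep : LegsIndependent H (spine q)) where
  private
    G : Graph (suc n)
    G = H [ S ]
  open ScorpionTuple G q r

  -- Every vertex other than b is matched with the edge to its parent, so the scorpion has n edges.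
  Parent : Fin (suc n) → Fin (suc n) → Set
  Parent p v = (∃[ i ] (lookup Q (inject₁ i) ≡ p × lookup Q (suc i) ≡ v)) ⊎ (b ≡ p × IsLeg Q v)

  parent : ∀ {v} → v ≢ b → ∃[ p ] Parent p v
  parent {v} v≢b with onSpine? Q v
  ... | inj₁ (zero  , eq) = contradiction (sym eq) v≢b
  ... | inj₁ (suc i , eq) = _ , inj₁ (i , refl , eq)
  ... | inj₂ leg          = b , inj₂ (refl , leg)

  parent⇒≢b : ∀ {p v} → Parent p v → b ≢ v
  parent⇒≢b (inj₁ (i , _ , eq)) b≡v = case distinct (suc i) zero (trans eq (sym b≡v)) of λ ()
  parent⇒≢b (inj₂ (_ , leg))    b≡v = leg zero b≡v

  parent-functional : ∀ {p p′ v} → Parent p v → Parent p′ v → p ≡ p′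
  parent-functional (inj₁ (i , refl , eq)) (inj₁ (j , refl , eq′)) =
    cong (lookup Q ∘ inject₁) (Fin.suc-injective (distinct (suc i) (suc j) (trans eq (sym eq′))))
  parent-functional (inj₁ (i , _ , eq)) (inj₂ (_ , leg))    = contradiction eq (leg (suc i))
  parent-functional (inj₂ (_ , leg))    (inj₁ (j , _ , eq)) = contradiction eq (leg (suc j))
  parent-functional (inj₂ (refl , _))   (inj₂ (refl , _))   = refl

  -- Along the spine the parent has the smaller index, and a leg is nobody's parent. In
  -- `treeEdge-injective` this keeps two vertices from claiming the same unordered edge.
  parent-asym : ∀ {p v} → Parent p v → ¬ Parent v p
  parent-asym (inj₁ (i , ip , iv)) (inj₁ (j , jv , jp)) =
    ℕ.m≢1+n+m (toℕ j) {1} (trans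
      (trans (sym (Fin.toℕ-inject₁ j)) (cong toℕ (distinct (inject₁ j) (suc i) (trans jv (sym iv)))))
      (cong suc (trans (sym (Fin.toℕ-inject₁ i)) (cong toℕ (distinct (inject₁ i) (suc j) (trans ip (sym jp)))))))
  parent-asym (inj₁ (i , ip , _)) (inj₂ (_ , leg))    = leg (inject₁ i) ip
  parent-asym (inj₂ (_ , leg))    (inj₁ (j , jv , _)) = leg (inject₁ j) jv
  parent-asym (inj₂ (b≡p , _))    (inj₂ (_ , leg))    = leg zero b≡p

  parent⇒adj : ∀ {p v} → Parent p v → Adj G p v
  parent⇒adj (inj₁ (i , refl , refl)) =
    Equivalence.from (inducedPath (inject₁ i) (suc i)) (inj₁ (cong suc (Fin.toℕ-inject₁ i)))
  parent⇒adj {v = v} (inj₂ (refl , leg)) = b-legs v leg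

  consecutive⇒parent : ∀ {i j : Fin (2 + ℓ)} → suc (toℕ i) ≡ toℕ j → Parent (lookup Q i) (lookup Q j)
  consecutive⇒parent {i} {suc j} eq =
    inj₁ (j , cong (lookup Q) (Fin.toℕ-injective (trans (Fin.toℕ-inject₁ j) (sym (ℕ.suc-injective eq)))) , refl)

  -- The scorpion conditions leave edges between legs as the only possible exceptions, and
  -- independence in `H` excludes those.
  adj⇒parent : ∀ {u v} → Adj G u v → Parent u v ⊎ Parent v u
  adj⇒parent {u} {v} a with onSpine? Q u | onSpine? Q v
  ... | inj₁ (i , refl) | inj₁ (j , refl) =
          Sum.map consecutive⇒parent consecutive⇒parent (Equivalence.to (inducedPath i j) a)
  ... | inj₁ (i , refl) | inj₂ v-leg = inj₁ (inj₂ (sym (only-b i v v-leg a) , v-leg))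
  ... | inj₂ u-leg | inj₁ (j , refl) = inj₂ (inj₂ (sym (only-b j u u-leg (Adj-sym G a)) , u-leg))
  ... | inj₂ u-leg | inj₂ v-leg = contradiction (proj₁ (adj-[]⁻ H S a)) (indep u-leg v-leg)

  -- `punchIn b` enumerates the `n` vertices other than the root `b`, which is why the graph is
  -- taken on `suc n` vertices.
  parentOf : ∀ i → ∃[ p ] Parent p (punchIn b i)
  parentOf i = parent (Fin.punchInᵢ≢i b i)

  treeEdge : Fin n → Edge (suc n)
  treeEdge i = sortEdge (proj₁ (parentOf i)) (punchIn b i)

  treeEdge-injective : ∀ {i j} → treeEdge i ≡ treeEdge j → i ≡ j
  treeEdge-injective {i} {j} eq with sortEdge-injective eq
  ... | inj₁ (_ , vᵢ≡vⱼ) = Fin.punchIn-injective b i j vᵢ≡vⱼ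
  ... | inj₂ (pᵢ≡vⱼ , vᵢ≡pⱼ) = contradiction
          (subst₂ Parent (sym vᵢ≡pⱼ) (sym pᵢ≡vⱼ) (proj₂ (parentOf j))) (parent-asym (proj₂ (parentOf i)))

  parent⇒treeEdge : ∀ {p v} → Parent p v → sortEdge p v ∈ˡ tabulate treeEdge
  parent⇒treeEdge {p} {v} pv = subst (_∈ˡ tabulate treeEdge) (cong₂ sortEdge pᵢ≡p vᵢ≡v) (∈-tabulate⁺ i)
    where
    i = punchOut (parent⇒≢b pv)
    vᵢ≡v = Fin.punchIn-punchOut (parent⇒≢b pv)
    pᵢ≡p = parent-functional (subst (Parent _) vᵢ≡v (proj₂ (parentOf i))) pv

  ∈S⇒treeEdge : ∀ {e} → e ∈ˡ S → e ∈ˡ tabulate treeEdge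
  ∈S⇒treeEdge {u , v} e∈ with u<v , a ← ∈-edges⁻ H (∈-subsets⇒⊆ (edges H) S∈ e∈) =
    [ subst (_∈ˡ tabulate treeEdge) (sortEdge-< u<v) ∘ parent⇒treeEdge
    , subst (_∈ˡ tabulate treeEdge) (sortEdge-> u<v) ∘ parent⇒treeEdge ]′ (adj⇒parent (adj-[]⁺ H S a e∈))

  treeEdge⇒∈S : ∀ {e} → e ∈ˡ tabulate treeEdge → e ∈ˡ S
  treeEdge⇒∈S e∈ with i , refl ← ∈-tabulate⁻ e∈
    with proj₂ (adj-[]⁻ H S (parent⇒adj (proj₂ (parentOf i))))
  ... | inj₁ up∈   = subst (_∈ˡ S) (sym (sortEdge-< (ordered up∈))) up∈
    where ordered = proj₁ ∘ ∈-edges⁻ H ∘ ∈-subsets⇒⊆ (edges H) S∈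
  ... | inj₂ down∈ = subst (_∈ˡ S) (sym (sortEdge-> (ordered down∈))) down∈
    where ordered = proj₁ ∘ ∈-edges⁻ H ∘ ∈-subsets⇒⊆ (edges H) S∈

  -- `S` and the list of tree edges have the same members and no repetitions, so one is a
  -- permutation of the other.
  length-S : length S ≡ n
  length-S = trans
    (↭-length (∼bag⇒↭ (unique∧set⇒bag (∈-subsets⇒unique (edges-unique H) S∈) (Unique.tabulate⁺ treeEdge-injective)
      (mk⇔ ∈S⇒treeEdge treeEdge⇒∈S))))
    (List.length-tabulate treeEdge)

-- All nonzero contributions to the enumerator have the sign (-1)ⁿ, so they cannot cancel.
module _ (H : Graph (suc n)) (q : Tuple (suc n) ℓ) (indep : LegsIndependent H (spine q)) where
  private
    term : List (Edge (suc n)) → ℤ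
    term S = sgn n *ᶻ (sgn (length S) *ᶻ tupleIndicator (H [ S ]) q)

    term-yes : ∀ {S} → S ∈ˡ subsets (edges H) → IsTuple (H [ S ]) q → term S ≡ 1ℤ
    term-yes {S} S∈ r = begin
      sgn n *ᶻ (sgn (length S) *ᶻ tupleIndicator (H [ S ]) q)
        ≡⟨ cong₂ (λ m x → sgn n *ᶻ (sgn m *ᶻ x)) (TreeEdges.length-S H S∈ q r indep) (tupleIndicator-true (H [ S ]) q r) ⟩
      sgn n *ᶻ (sgn n *ᶻ 1ℤ)  ≡⟨ cong (sgn n *ᶻ_) (ℤ.*-identityʳ (sgn n)) ⟩
      sgn n *ᶻ sgn n          ≡⟨ sgn-square n ⟩
      1ℤ                      ∎
      where open ≡-Reasoning

    term-no : ∀ {S} → ¬ IsTuple (H [ S ]) q → term S ≡ 0ℤ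
    term-no {S} ¬r = begin
      sgn n *ᶻ (sgn (length S) *ᶻ tupleIndicator (H [ S ]) q)
        ≡⟨ cong (λ x → sgn n *ᶻ (sgn (length S) *ᶻ x)) (tupleIndicator-false (H [ S ]) q ¬r) ⟩
      sgn n *ᶻ (sgn (length S) *ᶻ 0ℤ)  ≡⟨ cong (sgn n *ᶻ_) (ℤ.*-zeroʳ (sgn (length S))) ⟩
      sgn n *ᶻ 0ℤ                      ≡⟨ ℤ.*-zeroʳ (sgn n) ⟩
      0ℤ                               ∎
      where open ≡-Reasoning

    term-nonneg : ∀ {S} → S ∈ˡ subsets (edges H) → 0ℤ ℤ.≤ term S
    term-nonneg {S} S∈ = case isTuple? (H [ S ]) q of λ where
      (yes r) → subst (0ℤ ℤ.≤_) (sym (term-yes S∈ r)) (+≤+ z≤n)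
      (no ¬r) → ℤ.≤-reflexive (sym (term-no {S} ¬r))

  independent⇒nonneg : 0ℤ ℤ.≤ sgn n *ᶻ tupleSum H q
  independent⇒nonneg = subst (0ℤ ℤ.≤_) (sym (∑-*ˡ (sgn n) (subsets (edges H)) _)) (∑-nonneg _ term-nonneg)

  independent⇒pos : ∀ {S} → S ∈ˡ subsets (edges H) → IsTuple (H [ S ]) q → 0ℤ ℤ.< sgn n *ᶻ tupleSum H q
  independent⇒pos S∈ r = subst (0ℤ ℤ.<_) (sym (∑-*ˡ (sgn n) (subsets (edges H)) _))
    (∑-pos term-nonneg S∈ (subst (0ℤ ℤ.<_) (sym (term-yes S∈ r)) (+<+ (s≤s z≤n))))

-- The factor `sgn n` is the same for every tuple, so different tuples cannot cancel each other
-- either.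
tupleSum-nonneg : (H : Graph (suc n)) (q : Tuple (suc n) ℓ) → 0ℤ ℤ.≤ sgn n *ᶻ tupleSum H q
tupleSum-nonneg {n} H q = case legEdge? H (spine q) of λ where
  (inj₁ (_ , _ , u-leg , v-leg , a)) → ℤ.≤-reflexive (sym
        (trans (cong (sgn n *ᶻ_) (tupleSum-vanishes H q u-leg v-leg a)) (ℤ.*-zeroʳ (sgn n))))
  (inj₂ indep) → independent⇒nonneg H q indep

-- After multiplication by `sgn n`, all tuples contribute nonnegatively and `q` contributes
-- positively; the outer sign is a power of -1 and cannot be zero.
spanningTuple⇒enumerator≢0 : 1 ≤ ℓ → ℓ + 4 ≤ suc n → (H : Graph (suc n)) (q : Tuple (suc n) ℓ) →
                             LegsIndependent H (spine q) → ∀ {S} → S ∈ˡ subsets (edges H) → IsTuple (H [ S ]) q →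
                             alternatingEnumerator (Ψ ℓ) H ≢ 0ℤ
spanningTuple⇒enumerator≢0 {ℓ} {n} 1≤ℓ ℓ+4≤n H q indep S∈ r ≡0 =
  case ℤ.i*j≡0⇒i≡0∨j≡0 (sgn (length (edges H))) (trans (sym (enumerator-Ψ 1≤ℓ ℓ+4≤n H)) ≡0) of λ where
    (inj₁ sgn≡0) → case ℤ.i^n≡0⇒i≡0 -1ℤ (length (edges H)) sgn≡0 of λ ()
    (inj₂ sum≡0) → ℤ.<⇒≢ total-pos (sym (trans (cong (sgn n *ᶻ_) sum≡0) (ℤ.*-zeroʳ (sgn n))))
  where
  total-pos : 0ℤ ℤ.< sgn n *ᶻ ∑ (allTuples (suc n) ℓ) (tupleSum H)
  total-pos = subst (0ℤ ℤ.<_) (sym (∑-*ˡ (sgn n) (allTuples (suc n) ℓ) _))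
    (∑-pos (λ {q} _ → tupleSum-nonneg H q) (∈-allTuples q) (independent⇒pos H q indep S∈ r))

-- The extremal graph

module Extremal (ℓ : ℕ) {n : ℕ} (ℓ+4≤n : ℓ + 4 ≤ suc n) where

  3+ℓ≤n : 3 + ℓ ≤ n
  3+ℓ≤n = ℕ.≤-pred (subst (_≤ suc n) (ℕ.+-comm ℓ 4) ℓ+4≤n)

  2+ℓ≤n : 2 + ℓ ≤ n
  2+ℓ≤n = ℕ.≤-trans (ℕ.n≤1+n _) 3+ℓ≤n

  2+ℓ≤1+n : 2 + ℓ ≤ suc n
  2+ℓ≤1+n = ℕ.≤-trans 2+ℓ≤n (ℕ.n≤1+n n)

  -- The clique side of the join; the remaining vertices form the independent side.
  Low : Fin (suc n) → Set
  Low v = toℕ v < 2 + ℓ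

  JoinAdj : Fin (suc n) → Fin (suc n) → Set
  JoinAdj u v = u ≢ v × (Low u ⊎ Low v)

  joinAdj? : ∀ u v → Dec (JoinAdj u v)
  joinAdj? u v = ¬? (u Fin.≟ v) ×-dec ((toℕ u <? 2 + ℓ) ⊎-dec (toℕ v <? 2 + ℓ))

  joinAdj-sym : ∀ {u v} → JoinAdj u v → JoinAdj v u
  joinAdj-sym (u≢v , low) = u≢v ∘ sym , Sum.swap low

  join : Graph (suc n)
  join = record
    { adj        = λ u v → does (joinAdj? u v)
    ; adj-sym    = λ u v → does-⇔ (mk⇔ joinAdj-sym joinAdj-sym) (joinAdj? u v) (joinAdj? v u)
    ; adj-irrefl = λ v → dec-false (joinAdj? v v) λ (v≢v , _) → v≢v refl
    }

  low : Fin (2 + ℓ) → Fin (suc n)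
  low i = inject≤ i 2+ℓ≤1+n

  low-injective : Injective _≡_ _≡_ low
  low-injective eq = Fin.inject≤-injective 2+ℓ≤1+n 2+ℓ≤1+n _ _ eq

  -- A spine ends in a snoc, so the list of low vertices is split by `initLast`; the equation is
  -- kept to compute lookups.
  tuple,spine : ∃[ q ] spine {ℓ = ℓ} q ≡ Vec.tabulate low
  tuple,spine with t , s , eq ← initLast (Vec.tabulate (low ∘ suc)) = (zero , t , s) , cong (zero ∷_) (sym eq)

  tuple : Tuple (suc n) ℓ
  tuple = proj₁ tuple,spine

  Q : Vec (Fin (suc n)) (2 + ℓ)
  Q = spine tuple

  lookup-Q : ∀ i → lookup Q i ≡ low i
  lookup-Q i = trans (cong (λ v → lookup v i) (proj₂ tuple,spine)) (Vec.lookup∘tabulate low i)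

  toℕ-Q : ∀ i → toℕ (lookup Q i) ≡ toℕ i
  toℕ-Q i = trans (cong toℕ (lookup-Q i)) (Fin.toℕ-inject≤ i 2+ℓ≤1+n)

  leg⇒high : ∀ {v} → IsLeg Q v → 2 + ℓ ≤ toℕ v
  leg⇒high {v} leg = ℕ.≮⇒≥ λ v<2+ℓ →
    leg (fromℕ< v<2+ℓ) (Fin.toℕ-injective (trans (toℕ-Q _) (Fin.toℕ-fromℕ< v<2+ℓ)))

  legs-independent : LegsIndependent join Q
  legs-independent u-leg v-leg a with T-does⁻ (joinAdj? _ _) a
  ... | _ , inj₁ u<2+ℓ = ℕ.<⇒≱ u<2+ℓ (leg⇒high u-leg)
  ... | _ , inj₂ v<2+ℓ = ℕ.<⇒≱ v<2+ℓ (leg⇒high v-leg)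

  -- The edges of a spanning ℓ-scorpion, directed away from b = 0.
  Arc : ℕ → ℕ → Set
  Arc a c = (suc a ≡ c × c < 2 + ℓ) ⊎ (a ≡ 0 × 2 + ℓ ≤ c)

  arc? : ∀ a c → Dec (Arc a c)
  arc? a c = ((suc a ℕ.≟ c) ×-dec (c <? 2 + ℓ)) ⊎-dec ((a ℕ.≟ 0) ×-dec (2 + ℓ ≤? c))

  arcs : List (Edge (suc n))
  arcs = filter (λ (u , v) → arc? (toℕ u) (toℕ v)) (edges join)

  G : Graph (suc n)
  G = join [ arcs ]

  -- Arcs thus already have the orientation in which `edges` stores a pair.
  arc-< : ∀ {a c} → Arc a c → a < c
  arc-< (inj₁ (refl , _))    = ℕ.n<1+n _
  arc-< (inj₂ (refl , high)) = ℕ.≤-trans (s≤s z≤n) high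

  arc-low : ∀ {a c} → Arc a c → a < 2 + ℓ
  arc-low (inj₁ (refl , c<2+ℓ)) = ℕ.<⇒≤ c<2+ℓ
  arc-low (inj₂ (refl , _))     = s≤s z≤n

  arc⇒adj : ∀ {u v} → Arc (toℕ u) (toℕ v) → Adj G u v
  arc⇒adj {u} {v} arc = adj-[]⁺ join arcs a
    (∈-filter⁺ (λ (u , v) → arc? (toℕ u) (toℕ v)) (∈-edges⁺ join (arc-< arc) a) arc)
    where
    a : Adj join u v
    a = T-does⁺ (joinAdj? u v) ((λ { refl → ℕ.<-irrefl refl (arc-< arc) }) , inj₁ (arc-low arc))

  adj⇒arc : ∀ {u v} → Adj G u v → Arc (toℕ u) (toℕ v) ⊎ Arc (toℕ v) (toℕ u)
  adj⇒arc a = Sum.map fromArcs fromArcs (proj₂ (adj-[]⁻ join arcs a))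
    where
    fromArcs : ∀ {u v} → (u , v) ∈ˡ arcs → Arc (toℕ u) (toℕ v)
    fromArcs e∈ = proj₂ (∈-filter⁻ (λ (u , v) → arc? (toℕ u) (toℕ v)) {xs = edges join} e∈)

  arc-consecutive : ∀ {i j : Fin (2 + ℓ)} → Arc (toℕ (lookup Q i)) (toℕ (lookup Q j)) → suc (toℕ i) ≡ toℕ j
  arc-consecutive {i} {j} arc with subst₂ Arc (toℕ-Q i) (toℕ-Q j) arc
  ... | inj₁ (eq , _)   = eq
  ... | inj₂ (_ , high) = contradiction (Fin.toℕ<n j) (ℕ.≤⇒≯ high)

  consecutive-arc : ∀ {i j : Fin (2 + ℓ)} → suc (toℕ i) ≡ toℕ j → Arc (toℕ (lookup Q i)) (toℕ (lookup Q j))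
  consecutive-arc {i} {j} eq = subst₂ Arc (sym (toℕ-Q i)) (sym (toℕ-Q j)) (inj₁ (eq , Fin.toℕ<n j))

  isTuple : IsTuple G tuple
  isTuple = record
    { distinct    = λ i j eq → Fin.toℕ-injective (trans (sym (toℕ-Q i)) (trans (cong toℕ eq) (toℕ-Q j)))
    ; inducedPath = λ i j → mk⇔
        (Sum.map arc-consecutive arc-consecutive ∘ adj⇒arc)
        [ arc⇒adj ∘ consecutive-arc , Adj-sym G ∘ arc⇒adj ∘ consecutive-arc ]′
    ; b-legs      = λ v leg → arc⇒adj (inj₂ (refl , leg⇒high leg))
    ; only-b      = λ i v leg a → only-b i leg (adj⇒arc a)
    }
    where
    only-b : ∀ i {v} → IsLeg Q v → Arc (toℕ (lookup Q i)) (toℕ v) ⊎ Arc (toℕ v) (toℕ (lookup Q i)) → lookup Q i ≡ zero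
    only-b i leg (inj₁ (inj₁ (_ , v<2+ℓ))) = contradiction (leg⇒high leg) (ℕ.<⇒≱ v<2+ℓ)
    only-b i leg (inj₁ (inj₂ (eq , _)))    = Fin.toℕ-injective eq
    only-b i leg (inj₂ arc)                = contradiction (leg⇒high leg) (ℕ.<⇒≱ (arc-low arc))

  enumerator≢0 : 1 ≤ ℓ → alternatingEnumerator (Ψ ℓ) join ≢ 0ℤ
  enumerator≢0 1≤ℓ = spanningTuple⇒enumerator≢0 1≤ℓ ℓ+4≤n join tuple legs-independent
    (filter∈subsets _ (edges join)) isTuple

  -- Either `C` contains all `ℓ + 2` clique vertices, or it misses one of them; that one is adjacent
  -- to everything else, so `C` contains the other `n` vertices.
  cover-size : ∀ {C} → IsVertexCover join C → 2 + ℓ ≤ ∣ C ∣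
  cover-size {C} cover with Fin.all? (λ i → low i ∈? C)
  ... | yes low∈ = injection-into⇒≤ low-injective low∈
  ... | no ¬low∈ with i , u∉ ← Fin.¬∀⟶∃¬ (2 + ℓ) _ (λ i → low i ∈? C) ¬low∈ =
        ℕ.≤-trans 2+ℓ≤n (injection-into⇒≤ (Fin.punchIn-injective u _ _) others∈)
    where
    u = low i
    others∈ : ∀ j → punchIn u j ∈ C
    others∈ j = [ (λ u∈ → contradiction u∈ u∉) , id ]′ (cover u (punchIn u j)
      (T-does⁺ (joinAdj? u (punchIn u j))
        (Fin.punchInᵢ≢i u j ∘ sym , inj₁ (subst (_< 2 + ℓ) (sym (Fin.toℕ-inject≤ i 2+ℓ≤1+n)) (Fin.toℕ<n i)))))

  ℓ+2≤vertexCoverNumber : ℓ + 2 ≤ vertexCoverNumber join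
  ℓ+2≤vertexCoverNumber with C , cover , size ← proj₁ (proj₂ (leastCoverSize join)) =
    subst₂ _≤_ (ℕ.+-comm 2 ℓ) size (cover-size cover)

mainTheorem7 : ∀ (ℓ k : ℕ) → 1 ≤ ℓ → ℓ + 4 ≤ k → τ (Ψ ℓ) ⟨ k ⟩≐ (ℓ + 2)
-- Impossible, as `ℓ + 4 ≤ 0`; writing `k` as `suc n` lets the scorpions below have `n` edges.
mainTheorem7 ℓ zero    1≤ℓ ℓ+4≤k = contradiction (ℕ.m+n≤o⇒n≤o ℓ ℓ+4≤k) λ ()
mainTheorem7 ℓ (suc n) 1≤ℓ ℓ+4≤k =
    (join , enumerator≢0 1≤ℓ , ℕ.≤-antisym (upper join (enumerator≢0 1≤ℓ)) ℓ+2≤vertexCoverNumber)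
  , upper
  where
  open Extremal ℓ ℓ+4≤k
  upper = enumerator≢0⇒cover≤ 1≤ℓ ℓ+4≤k
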